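{- $\mathsf{LC}$ is decidable: there is an algorithm deciding, for any modal proposition $A$, whether $\mathsf{LC}\vdash A$.
   Context: Modal language: propositional variables, $\bot$, $\wedge,\vee,\to$, $\Box$. $\mathsf{iGL}$: intuitionistic propositional logic in the modal language plus $\Box(A\to B)\to(\Box A\to\Box B)$, $\Box A\to\Box\Box A$, $\Box(\Box A\to A)\to\Box A$, closed under modus ponens and necessitation. $\mathsf{LC}:=\mathsf{iGL}+\{A\to\Box A\}$. -}

module Defs where

open import Data.Nat using (ℕ)
open import Level using (0ℓ)
open import Relation.Unary using (Pred; _∪_)

infix  9 □_
infixr 8 _∧_
infixr 7 _∨_
infixr 6 _⇒_
infix  4 _⊢_

data Formula : Set where
  var         : ℕ → Formula
  ⊥           : Formula
  _∧_ _∨_ _⇒_ : Formula → Formula → Formula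
  □_          : Formula → Formula

-- Hilbert axiom schemes for intuitionistic propositional logic, instantiated
-- with arbitrary modal formulas.
data IPC : Pred Formula 0ℓ where
  ⇒-K  : ∀ A B   → IPC (A ⇒ B ⇒ A)
  ⇒-S  : ∀ A B C → IPC ((A ⇒ B ⇒ C) ⇒ (A ⇒ B) ⇒ A ⇒ C)
  ∧-I  : ∀ A B   → IPC (A ⇒ B ⇒ A ∧ B)
  ∧-E₁ : ∀ A B   → IPC (A ∧ B ⇒ A)
  ∧-E₂ : ∀ A B   → IPC (A ∧ B ⇒ B)
  ∨-I₁ : ∀ A B   → IPC (A ⇒ A ∨ B)
  ∨-I₂ : ∀ A B   → IPC (B ⇒ A ∨ B)
  ∨-E  : ∀ A B C → IPC ((A ⇒ C) ⇒ (B ⇒ C) ⇒ A ∨ B ⇒ C)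
  ⊥-E  : ∀ A     → IPC (⊥ ⇒ A)

data GL : Pred Formula 0ℓ where
  distribution : ∀ A B → GL (□ (A ⇒ B) ⇒ □ A ⇒ □ B)
  transitivity : ∀ A   → GL (□ A ⇒ □ □ A)
  löb          : ∀ A   → GL (□ (□ A ⇒ A) ⇒ □ A)

data Completeness : Pred Formula 0ℓ where
  completeness : ∀ A → Completeness (A ⇒ □ A)

-- A logic is given by its set of axioms; its theorems are the closure of that
-- set under modus ponens and necessitation. Hence T + X is the union T ∪ X.
data _⊢_ (T : Pred Formula 0ℓ) : Pred Formula 0ℓ where
  axiom         : ∀ {A}   → T A → T ⊢ A
  modusPonens   : ∀ {A B} → T ⊢ A ⇒ B → T ⊢ A → T ⊢ B
  necessitation : ∀ {A}   → T ⊢ A → T ⊢ □ A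

iGL : Pred Formula 0ℓ
iGL = IPC ∪ GL

LC : Pred Formula 0ℓ
LC = iGL ∪ Completeness

{-# OPTIONS --safe #-}

-- LC is complete for Kripke models in which the modal relation ⊏ is contained
-- in the intuitionistic order and conversely well-founded. Fix the finite set S
-- of subformulas of A. A context Γ ⊆ S either can be enlarged by a formula of S
-- without changing its consequences (or splits along a disjunction), or is
-- saturated, and then it is a world whose true formulas in S are its members.
-- Every failing implication A ⇒ B leads to a context containing A, and
-- every failing □ A leads, by Löb's axiom, to a context containing □ A; as
-- A ⇒ □ A lets contexts grow along ⊏ as well, they strictly increase inside S.
-- So the search for a proof or a saturated context refuting A terminates.
module Submission where

open import Defs
open import Data.Empty using () renaming (⊥ to Empty)
open import Data.List.Base using (List; []; _∷_; _++_; length; filter; mapMaybe)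
open import Data.List.Membership.Propositional using (_∈_; _∉_)
open import Data.List.Membership.Propositional.Properties
  using (∈-++⁺ˡ; ∈-++⁺ʳ; ∈-++⁻)
open import Data.List.Properties using (filter-accept; filter-reject)
open import Data.List.Relation.Binary.Subset.Propositional using (_⊆_)
open import Data.List.Relation.Unary.All as All using (All; []; _∷_)
open import Data.List.Relation.Unary.Any using (here; there)
open import Data.Maybe.Base using (just; nothing)
open import Data.Nat using (ℕ; _≤_; _<_; z≤n; s≤s)
import Data.Nat as ℕ
open import Data.Nat.Induction using (<-wellFounded)
open import Data.Nat.Properties using (m≤n⇒m≤1+n)
open import Data.Product using (_×_; _,_; proj₁; proj₂; ∃-syntax)
open import Data.Sum using (_⊎_; inj₁; inj₂; [_,_])
open import Data.Unit using (⊤; tt)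
open import Function.Base using (_∘_; id; flip; _on_)
open import Induction.WellFounded using (WellFounded; Acc; acc; module Subrelation)
import Relation.Binary.Construct.On as On
open import Relation.Binary.Definitions using (DecidableEquality)
open import Relation.Binary.PropositionalEquality using (_≡_; refl; cong; cong₂)
open import Relation.Nullary using (Dec; yes; no; ¬_; ¬?; contradiction)
open import Relation.Nullary.Decidable using (map′; _×-dec_)
open import Relation.Unary using (Pred; Decidable; _∪_) renaming (_⊆_ to _⋐_)

-- Searching and counting in finite lists

module _ {a p q} {A : Set a} {P : Pred A p} {Q : Set q} where

  All-⊎⁻ : ∀ {xs} → All (λ x → P x ⊎ Q) xs → All P xs ⊎ Q
  All-⊎⁻ []              = inj₁ []
  All-⊎⁻ (inj₂ q ∷ _)    = inj₂ q
  All-⊎⁻ (inj₁ p ∷ pqs) with All-⊎⁻ pqs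
  ... | inj₁ ps = inj₁ (p ∷ ps)
  ... | inj₂ q  = inj₂ q

module _ {a p q} {A : Set a} {P : Pred A p} {Q : Pred A q}
         (P? : Decidable P) (Q? : Decidable Q) (P⇒Q : P ⋐ Q) where

  length-filter-≤ : ∀ xs → length (filter P? xs) ≤ length (filter Q? xs)
  length-filter-≤ []       = z≤n
  length-filter-≤ (x ∷ xs) with P? x | Q? x
  ... | yes _ | yes _  = s≤s (length-filter-≤ xs)
  ... | yes p | no ¬q  = contradiction (P⇒Q p) ¬q
  ... | no _  | yes _  = m≤n⇒m≤1+n (length-filter-≤ xs)
  ... | no _  | no _   = length-filter-≤ xs

  length-filter-< : ∀ {x xs} → x ∈ xs → Q x → ¬ P x →
                    length (filter P? xs) < length (filter Q? xs)
  length-filter-< {x} {xs = _ ∷ xs} (here refl) q ¬p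
    rewrite filter-accept Q? {xs = xs} q | filter-reject P? {xs = xs} ¬p =
    s≤s (length-filter-≤ xs)
  length-filter-< {xs = y ∷ _} (there x∈) q ¬p with P? y | Q? y
  ... | yes _ | yes _  = s≤s (length-filter-< x∈ q ¬p)
  ... | yes p | no ¬q  = contradiction (P⇒Q p) ¬q
  ... | no _  | yes _  = m≤n⇒m≤1+n (length-filter-< x∈ q ¬p)
  ... | no _  | no _   = length-filter-< x∈ q ¬p

-- Decidable equality of formulas

connective : Formula → ℕ
connective (var _) = 0
connective ⊥       = 1
connective (_ ∧ _) = 2
connective (_ ∨ _) = 3
connective (_ ⇒ _) = 4
connective (□ _)   = 5

infix 4 _≟_

_≟_ : DecidableEquality Formula
-- Comparing head connectives first leaves six cases: for mixed pairs the equation between codes is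
-- absurd.
≟-aux : ∀ A B → connective A ≡ connective B → Dec (A ≡ B)

A ≟ B with connective A ℕ.≟ connective B
... | yes eq = ≟-aux A B eq
... | no  ne = no (ne ∘ cong connective)

≟-aux (var p) (var q) _ = map′ (cong var) (λ { refl → refl }) (p ℕ.≟ q)
≟-aux ⊥       ⊥       _ = yes refl
≟-aux (A ∧ B) (C ∧ D) _ =
  map′ (λ (p , q) → cong₂ _∧_ p q) (λ { refl → refl , refl }) ((A ≟ C) ×-dec (B ≟ D))
≟-aux (A ∨ B) (C ∨ D) _ =
  map′ (λ (p , q) → cong₂ _∨_ p q) (λ { refl → refl , refl }) ((A ≟ C) ×-dec (B ≟ D))
≟-aux (A ⇒ B) (C ⇒ D) _ =
  map′ (λ (p , q) → cong₂ _⇒_ p q) (λ { refl → refl , refl }) ((A ≟ C) ×-dec (B ≟ D))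
≟-aux (□ A)   (□ B)   _ = map′ (cong □_) (λ { refl → refl }) (A ≟ B)

open import Data.List.Membership.DecPropositional _≟_ using (_∈?_)

-- Subformulas and closure under them

children : Formula → List Formula
children (var _) = []
children ⊥       = []
children (A ∧ B) = A ∷ B ∷ []
children (A ∨ B) = A ∷ B ∷ []
children (A ⇒ B) = A ∷ B ∷ []
children (□ A)   = A ∷ []

SubformulaClosed : List Formula → Set
SubformulaClosed S = ∀ {D} → D ∈ S → children D ⊆ S

subformulas : Formula → List Formula
subformulas A@(var _) = A ∷ []
subformulas A@⊥       = A ∷ []
subformulas A@(B ∧ C) = A ∷ subformulas B ++ subformulas C
subformulas A@(B ∨ C) = A ∷ subformulas B ++ subformulas C
subformulas A@(B ⇒ C) = A ∷ subformulas B ++ subformulas C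
subformulas A@(□ B)   = A ∷ subformulas B

∈-subformulas : ∀ A → A ∈ subformulas A
∈-subformulas (var _) = here refl
∈-subformulas ⊥       = here refl
∈-subformulas (_ ∧ _) = here refl
∈-subformulas (_ ∨ _) = here refl
∈-subformulas (_ ⇒ _) = here refl
∈-subformulas (□ _)   = here refl

∷-closed : ∀ {A S} → children A ⊆ S → SubformulaClosed S → SubformulaClosed (A ∷ S)
∷-closed A⊆S S-closed (here refl) = there ∘ A⊆S
∷-closed A⊆S S-closed (there D∈S) = there ∘ S-closed D∈S

++-closed : ∀ {S S′} → SubformulaClosed S → SubformulaClosed S′ → SubformulaClosed (S ++ S′)
++-closed {S} S-closed S′-closed D∈ with ∈-++⁻ S D∈
... | inj₁ D∈S  = ∈-++⁺ˡ ∘ S-closed D∈S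
... | inj₂ D∈S′ = ∈-++⁺ʳ S ∘ S′-closed D∈S′

children⊆subformulas++ : ∀ B C → B ∷ C ∷ [] ⊆ subformulas B ++ subformulas C
children⊆subformulas++ B C (here refl)         = ∈-++⁺ˡ (∈-subformulas B)
children⊆subformulas++ B C (there (here refl)) = ∈-++⁺ʳ (subformulas B) (∈-subformulas C)

subformulas-closed : ∀ A → SubformulaClosed (subformulas A)
subformulas-closed (var _) = ∷-closed (λ ()) (λ ())
subformulas-closed ⊥       = ∷-closed (λ ()) (λ ())
subformulas-closed (B ∧ C) =
  ∷-closed (children⊆subformulas++ B C) (++-closed (subformulas-closed B) (subformulas-closed C))
subformulas-closed (B ∨ C) =
  ∷-closed (children⊆subformulas++ B C) (++-closed (subformulas-closed B) (subformulas-closed C))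
subformulas-closed (B ⇒ C) =
  ∷-closed (children⊆subformulas++ B C) (++-closed (subformulas-closed B) (subformulas-closed C))
subformulas-closed (□ B)   =
  ∷-closed (λ { (here refl) → ∈-subformulas B }) (subformulas-closed B)

-- Derivability from hypotheses

infix 4 _⊢ᴸ_

-- Necessitation may be applied to hypotheses: A ⇒ □ A makes this harmless.
_⊢ᴸ_ : List Formula → Formula → Set
Γ ⊢ᴸ A = LC ∪ (_∈ Γ) ⊢ A

⊢-mono : ∀ {T U : Pred Formula _} {A} → T ⋐ U → T ⊢ A → U ⊢ A
⊢-mono T⊆U (axiom a)         = axiom (T⊆U a)
⊢-mono T⊆U (modusPonens d e) = modusPonens (⊢-mono T⊆U d) (⊢-mono T⊆U e)
⊢-mono T⊆U (necessitation d) = necessitation (⊢-mono T⊆U d)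

module _ {Γ : List Formula} where

  hypothesis : ∀ {A} → A ∈ Γ → Γ ⊢ᴸ A
  hypothesis = axiom ∘ inj₂

  ipc : ∀ {A} → IPC A → Γ ⊢ᴸ A
  ipc = axiom ∘ inj₁ ∘ inj₁ ∘ inj₁

  gl : ∀ {A} → GL A → Γ ⊢ᴸ A
  gl = axiom ∘ inj₁ ∘ inj₁ ∘ inj₂

  ⇒-const : ∀ {A B} → Γ ⊢ᴸ B → Γ ⊢ᴸ A ⇒ B
  ⇒-const = modusPonens (ipc (⇒-K _ _))

  ⇒-app : ∀ {A B C} → Γ ⊢ᴸ A ⇒ B ⇒ C → Γ ⊢ᴸ A ⇒ B → Γ ⊢ᴸ A ⇒ C
  ⇒-app d e = modusPonens (modusPonens (ipc (⇒-S _ _ _)) d) e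

  deduction : ∀ {A B} → A ∷ Γ ⊢ᴸ B → Γ ⊢ᴸ A ⇒ B
  deduction (axiom (inj₁ a))              = ⇒-const (axiom (inj₁ a))
  deduction {A} (axiom (inj₂ (here refl))) = ⇒-app (ipc (⇒-K A (A ⇒ A))) (ipc (⇒-K A A))
  deduction (axiom (inj₂ (there B∈Γ)))    = ⇒-const (hypothesis B∈Γ)
  deduction (modusPonens d e)             = ⇒-app (deduction d) (deduction e)
  -- Composing `A ⇒ B` with the completeness axiom `B ⇒ □ B` replaces necessitation under the
  -- hypothesis `A`.
  deduction (necessitation {B} d)         =
    ⇒-app (⇒-const (axiom (inj₁ (inj₂ (completeness B))))) (deduction d)

  cut : ∀ {A B} → Γ ⊢ᴸ A → A ∷ Γ ⊢ᴸ B → Γ ⊢ᴸ B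
  cut d e = modusPonens (deduction e) d

  ∨-elim : ∀ {A B C} → Γ ⊢ᴸ A ∨ B → A ∷ Γ ⊢ᴸ C → B ∷ Γ ⊢ᴸ C → Γ ⊢ᴸ C
  ∨-elim d e f =
    modusPonens (modusPonens (modusPonens (ipc (∨-E _ _ _)) (deduction e)) (deduction f)) d

  □-map : ∀ {A B} → Γ ⊢ᴸ □ (A ⇒ B) → Γ ⊢ᴸ □ A → Γ ⊢ᴸ □ B
  □-map d e = modusPonens (modusPonens (gl (distribution _ _)) d) e

-- Only `Θ` needs boxes: the deduction theorem discharges it, necessitation applies with `Γ` kept as
-- hypotheses, and distribution detaches the boxed formulas one by one.
□-intro : ∀ {Γ Θ A} → All (λ B → Γ ⊢ᴸ □ B) Θ → Θ ++ Γ ⊢ᴸ A → Γ ⊢ᴸ □ A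
□-intro []       d = necessitation d
□-intro (e ∷ es) d = □-map (□-intro es (deduction d)) e

unbox : List Formula → List Formula
unbox = mapMaybe λ { (□ A) → just A ; _ → nothing }

∈-unbox⁺ : ∀ {A Γ} → □ A ∈ Γ → A ∈ unbox Γ
∈-unbox⁺ {Γ = □ _ ∷ _}     (here refl) = here refl
∈-unbox⁺ {Γ = var _ ∷ _}   (there i)   = ∈-unbox⁺ i
∈-unbox⁺ {Γ = ⊥ ∷ _}       (there i)   = ∈-unbox⁺ i
∈-unbox⁺ {Γ = (_ ∧ _) ∷ _} (there i)   = ∈-unbox⁺ i
∈-unbox⁺ {Γ = (_ ∨ _) ∷ _} (there i)   = ∈-unbox⁺ i
∈-unbox⁺ {Γ = (_ ⇒ _) ∷ _} (there i)   = ∈-unbox⁺ i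
∈-unbox⁺ {Γ = □ _ ∷ _}     (there i)   = there (∈-unbox⁺ i)

∈-unbox⁻ : ∀ {A} Γ → A ∈ unbox Γ → □ A ∈ Γ
∈-unbox⁻ (var _ ∷ Γ)   i           = there (∈-unbox⁻ Γ i)
∈-unbox⁻ (⊥ ∷ Γ)       i           = there (∈-unbox⁻ Γ i)
∈-unbox⁻ ((_ ∧ _) ∷ Γ) i           = there (∈-unbox⁻ Γ i)
∈-unbox⁻ ((_ ∨ _) ∷ Γ) i           = there (∈-unbox⁻ Γ i)
∈-unbox⁻ ((_ ⇒ _) ∷ Γ) i           = there (∈-unbox⁻ Γ i)
∈-unbox⁻ (□ _ ∷ Γ)     (here refl) = here refl
∈-unbox⁻ (□ _ ∷ Γ)     (there i)   = there (∈-unbox⁻ Γ i)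

-- The box rule of the search. Deduction gives `□ A ⇒ A`, the boxes in `Γ` allow boxing it, and
-- Löb's axiom concludes. Keeping `Γ` in the premise lets contexts grow along `⊏`.
□-löb : ∀ {Γ A} → □ A ∷ unbox Γ ++ Γ ⊢ᴸ A → Γ ⊢ᴸ □ A
□-löb {Γ} d =
  modusPonens (gl (löb _))
    (□-intro (All.tabulate (hypothesis ∘ ∈-unbox⁻ Γ)) (deduction d))

-- Kripke semantics

-- `≼-⊏-trans` makes boxes persist along `≼`, and `⊏⇒≼` validates `A ⇒ □ A`; together they make `⊏`
-- transitive.
record KripkeModel : Set₁ where
  infix 4 _≼_ _⊏_ _⊩_
  field
    World    : Set
    _≼_      : World → World → Set
    _⊏_      : World → World → Set
    ≼-refl   : ∀ {w} → w ≼ w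
    ≼-trans  : ∀ {u v w} → u ≼ v → v ≼ w → u ≼ w
    ⊏⇒≼      : ∀ {v w} → v ⊏ w → v ≼ w
    ≼-⊏-trans : ∀ {u v w} → u ≼ v → v ⊏ w → u ⊏ w
    ⊐-wellFounded : WellFounded (flip _⊏_)
    V        : World → ℕ → Set
    V-mono   : ∀ {v w p} → v ≼ w → V v p → V w p

  _⊩_ : World → Formula → Set
  w ⊩ var p = V w p
  w ⊩ ⊥     = Empty
  w ⊩ A ∧ B = w ⊩ A × w ⊩ B
  w ⊩ A ∨ B = w ⊩ A ⊎ w ⊩ B
  w ⊩ A ⇒ B = ∀ {v} → w ≼ v → v ⊩ A → v ⊩ B
  w ⊩ □ A   = ∀ {v} → w ⊏ v → v ⊩ A

  ⊩-mono : ∀ A {v w} → v ≼ w → v ⊩ A → w ⊩ A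
  ⊩-mono (var _) v≼w a        = V-mono v≼w a
  ⊩-mono (A ∧ B) v≼w (a , b)  = ⊩-mono A v≼w a , ⊩-mono B v≼w b
  ⊩-mono (A ∨ B) v≼w (inj₁ a) = inj₁ (⊩-mono A v≼w a)
  ⊩-mono (A ∨ B) v≼w (inj₂ b) = inj₂ (⊩-mono B v≼w b)
  ⊩-mono (A ⇒ B) v≼w f        = λ w≼u → f (≼-trans v≼w w≼u)
  ⊩-mono (□ A)   v≼w f        = λ w⊏u → f (≼-⊏-trans v≼w w⊏u)

  ⊩-ipc : ∀ {A} → IPC A → ∀ {w} → w ⊩ A
  ⊩-ipc (⇒-K A B)   = λ _ a v≼w _ → ⊩-mono A v≼w a
  ⊩-ipc (⇒-S A B C) = λ _ f u≼v g v≼w a → f (≼-trans u≼v v≼w) a ≼-refl (g v≼w a)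
  ⊩-ipc (∧-I A B)   = λ _ a v≼w b → ⊩-mono A v≼w a , b
  ⊩-ipc (∧-E₁ A B)  = λ _ → proj₁
  ⊩-ipc (∧-E₂ A B)  = λ _ → proj₂
  ⊩-ipc (∨-I₁ A B)  = λ _ → inj₁
  ⊩-ipc (∨-I₂ A B)  = λ _ → inj₂
  ⊩-ipc (∨-E A B C) = λ _ f u≼v g v≼w → [ f (≼-trans u≼v v≼w) , g v≼w ]
  ⊩-ipc (⊥-E A)     = λ _ ()

  ⊩-löb : ∀ A {w} → w ⊩ □ (□ A ⇒ A) → w ⊩ □ A
  ⊩-löb A {w} f {v} w⊏v = go v (⊐-wellFounded v) w⊏v
    where
    go : ∀ v → Acc (flip _⊏_) v → w ⊏ v → v ⊩ A
    go v (acc rs) w⊏v =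
      -- By transitivity `u` is also a `⊏`-successor of `w`, so the induction hypothesis yields
      -- `□ A` at `v`.
      f w⊏v ≼-refl λ {u} v⊏u → go u (rs v⊏u) (≼-⊏-trans (⊏⇒≼ w⊏v) v⊏u)

  soundness : ∀ {A} → LC ⊢ A → ∀ {w} → w ⊩ A
  soundness (axiom (inj₁ (inj₁ a)))                       = ⊩-ipc a
  soundness (axiom (inj₁ (inj₂ (distribution A B))))      =
    λ _ f v≼w a w⊏u → f (≼-⊏-trans v≼w w⊏u) ≼-refl (a w⊏u)
  soundness (axiom (inj₁ (inj₂ (transitivity A))))        =
    λ _ a w⊏v v⊏u → a (≼-⊏-trans (⊏⇒≼ w⊏v) v⊏u)
  soundness (axiom (inj₁ (inj₂ (löb A))))                 = λ _ → ⊩-löb A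
  soundness (axiom (inj₂ (completeness A)))               = λ _ a w⊏v → ⊩-mono A (⊏⇒≼ w⊏v) a
  soundness (modusPonens d e)                             = soundness d ≼-refl (soundness e)
  soundness (necessitation d)                             = λ _ → soundness d

-- Saturated contexts and proof search

module Search (S : List Formula) (S-closed : SubformulaClosed S) where

  infix 4 _⊂_

  -- The new formula must lie in `S`, so that repetitions and formulas outside `S` do not count as
  -- growth and `missing` drops.
  _⊂_ : List Formula → List Formula → Set
  Γ ⊂ Δ = Γ ⊆ Δ × ∃[ D ] D ∈ S × D ∈ Δ × D ∉ Γ

  missing : List Formula → ℕ
  missing Γ = length (filter (λ D → ¬? (D ∈? Γ)) S)

  ⊂⇒missing-> : ∀ {Γ Δ} → Γ ⊂ Δ → missing Δ < missing Γ
  ⊂⇒missing-> (Γ⊆Δ , _ , D∈S , D∈Δ , D∉Γ) =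
    length-filter-< _ _ (_∘ Γ⊆Δ) D∈S D∉Γ λ D∉Δ → D∉Δ D∈Δ

  ⊃-wellFounded : WellFounded (flip _⊂_)
  ⊃-wellFounded =
    Subrelation.wellFounded ⊂⇒missing-> (On.wellFounded missing <-wellFounded)

  -- Conditions on `Γ` alone suffice: a larger world still contains the implication and satisfies
  -- its own clause, while boxes are handled by the definition of `⊏`.
  TrueClause : List Formula → Formula → Set
  TrueClause Γ (var _) = ⊤
  TrueClause Γ ⊥       = Empty
  TrueClause Γ (A ∧ B) = A ∈ Γ × B ∈ Γ
  TrueClause Γ (A ∨ B) = A ∈ Γ ⊎ B ∈ Γ
  TrueClause Γ (A ⇒ B) = A ∉ Γ ⊎ B ∈ Γ
  TrueClause Γ (□ _)   = ⊤

  data Saturated (Γ : List Formula) : Set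

  -- A false implication or box carries a saturated counterexample. The first alternative for
  -- `A ⇒ B` covers `A ∈ Γ`, where adding `A` would not enlarge the context.
  FalseClause : List Formula → Formula → Set
  FalseClause Γ (var _) = ⊤
  FalseClause Γ ⊥       = ⊤
  FalseClause Γ (A ∧ B) = A ∉ Γ ⊎ B ∉ Γ
  FalseClause Γ (A ∨ B) = A ∉ Γ × B ∉ Γ
  FalseClause Γ (A ⇒ B) =
    (A ∈ Γ × B ∉ Γ) ⊎ (∃[ Δ ] Saturated Δ × Γ ⊆ Δ × A ∈ Δ × B ∉ Δ)
  FalseClause Γ (□ A)   = ∃[ Δ ] Saturated Δ × Γ ⊂ Δ × unbox Γ ⊆ Δ × A ∉ Δ

  Clause : List Formula → Formula → Set
  Clause Γ D = (D ∈ Γ × TrueClause Γ D) ⊎ (D ∉ Γ × FalseClause Γ D)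

  data Saturated Γ where
    saturated : (∀ {D} → D ∈ S → Clause Γ D) → Saturated Γ

  -- The second alternative only speaks of membership; for `C` in `S` the canonical model turns it
  -- into underivability.
  Outcome : List Formula → Formula → Set
  Outcome Γ C = Γ ⊢ᴸ C ⊎ (∃[ Δ ] Saturated Δ × Γ ⊆ Δ × C ∉ Δ)

  -- An invertible rule with context Γ whose premises add one new formula each;
  -- it has no premise when Γ is inconsistent.
  Reduction : List Formula → Set
  Reduction Γ = ∃[ Ds ] All (λ D → D ∈ S × D ∉ Γ) Ds
                      × (∀ {C} → All (λ D → D ∷ Γ ⊢ᴸ C) Ds → Γ ⊢ᴸ C)

  derived : ∀ {Γ D} → D ∈ S → D ∉ Γ → Γ ⊢ᴸ D → Reduction Γ
  derived D∈S D∉Γ d = _ ∷ [] , (D∈S , D∉Γ) ∷ [] , λ { (e ∷ []) → cut d e }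

  ⊂-∷ : ∀ {Γ D} → D ∈ S → D ∉ Γ → Γ ⊂ D ∷ Γ
  ⊂-∷ D∈S D∉Γ = there , _ , D∈S , here refl , D∉Γ

  module _ {Γ : List Formula} (ih : ∀ {Δ} → Γ ⊂ Δ → ∀ C → Outcome Δ C) where

    -- A violated clause always exposes either an inconsistency or formulas of `S` that may be added
    -- to `Γ`.
    analyse : ∀ {D} → D ∈ S → Clause Γ D ⊎ Reduction Γ
    analyse {var p} D∈S with var p ∈? Γ
    ... | yes D∈Γ = inj₁ (inj₁ (D∈Γ , tt))
    ... | no D∉Γ  = inj₁ (inj₂ (D∉Γ , tt))
    analyse {⊥} D∈S with ⊥ ∈? Γ
    ... | yes D∈Γ = inj₂ ([] , [] , λ _ → modusPonens (ipc (⊥-E _)) (hypothesis D∈Γ))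
    ... | no D∉Γ  = inj₁ (inj₂ (D∉Γ , tt))
    analyse {A ∧ B} D∈S with (A ∧ B) ∈? Γ | A ∈? Γ | B ∈? Γ
    ... | yes D∈Γ | yes A∈Γ | yes B∈Γ = inj₁ (inj₁ (D∈Γ , A∈Γ , B∈Γ))
    ... | yes D∈Γ | no A∉Γ  | _       =
      inj₂ (derived (S-closed D∈S (here refl)) A∉Γ
        (modusPonens (ipc (∧-E₁ _ _)) (hypothesis D∈Γ)))
    ... | yes D∈Γ | yes _   | no B∉Γ  =
      inj₂ (derived (S-closed D∈S (there (here refl))) B∉Γ
        (modusPonens (ipc (∧-E₂ _ _)) (hypothesis D∈Γ)))
    ... | no D∉Γ  | yes A∈Γ | yes B∈Γ =
      inj₂ (derived D∈S D∉Γ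
        (modusPonens (modusPonens (ipc (∧-I _ _)) (hypothesis A∈Γ)) (hypothesis B∈Γ)))
    ... | no D∉Γ  | no A∉Γ  | _       = inj₁ (inj₂ (D∉Γ , inj₁ A∉Γ))
    ... | no D∉Γ  | yes _   | no B∉Γ  = inj₁ (inj₂ (D∉Γ , inj₂ B∉Γ))
    analyse {A ∨ B} D∈S with (A ∨ B) ∈? Γ | A ∈? Γ | B ∈? Γ
    ... | yes D∈Γ | yes A∈Γ | _       = inj₁ (inj₁ (D∈Γ , inj₁ A∈Γ))
    ... | yes D∈Γ | no _    | yes B∈Γ = inj₁ (inj₁ (D∈Γ , inj₂ B∈Γ))
    ... | yes D∈Γ | no A∉Γ  | no B∉Γ  =
      inj₂ (A ∷ B ∷ []
           , (S-closed D∈S (here refl) , A∉Γ) ∷ (S-closed D∈S (there (here refl)) , B∉Γ) ∷ []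
           , λ { (d ∷ e ∷ []) → ∨-elim (hypothesis D∈Γ) d e })
    ... | no D∉Γ  | yes A∈Γ | _       =
      inj₂ (derived D∈S D∉Γ (modusPonens (ipc (∨-I₁ _ _)) (hypothesis A∈Γ)))
    ... | no D∉Γ  | no _    | yes B∈Γ =
      inj₂ (derived D∈S D∉Γ (modusPonens (ipc (∨-I₂ _ _)) (hypothesis B∈Γ)))
    ... | no D∉Γ  | no A∉Γ  | no B∉Γ  = inj₁ (inj₂ (D∉Γ , A∉Γ , B∉Γ))
    analyse {A ⇒ B} D∈S with (A ⇒ B) ∈? Γ | A ∈? Γ | B ∈? Γ
    ... | yes D∈Γ | no A∉Γ  | _       = inj₁ (inj₁ (D∈Γ , inj₁ A∉Γ))
    ... | yes D∈Γ | yes _   | yes B∈Γ = inj₁ (inj₁ (D∈Γ , inj₂ B∈Γ))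
    ... | yes D∈Γ | yes A∈Γ | no B∉Γ  =
      inj₂ (derived (S-closed D∈S (there (here refl))) B∉Γ
        (modusPonens (hypothesis D∈Γ) (hypothesis A∈Γ)))
    ... | no D∉Γ  | _       | yes B∈Γ =
      inj₂ (derived D∈S D∉Γ (⇒-const (hypothesis B∈Γ)))
    ... | no D∉Γ  | yes A∈Γ | no B∉Γ  = inj₁ (inj₂ (D∉Γ , inj₁ (A∈Γ , B∉Γ)))
    -- Searching with `A` added either proves `A ⇒ B` or finds the world refuting it.
    ... | no D∉Γ  | no A∉Γ  | no B∉Γ  with ih (⊂-∷ (S-closed D∈S (here refl)) A∉Γ) B
    ...   | inj₁ d = inj₂ (derived D∈S D∉Γ (deduction d))
    ...   | inj₂ (Δ , Δ-sat , A∷Γ⊆Δ , B∉Δ) =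
      inj₁ (inj₂ (D∉Γ , inj₂ (Δ , Δ-sat , A∷Γ⊆Δ ∘ there , A∷Γ⊆Δ (here refl) , B∉Δ)))
    analyse {□ A} D∈S with □ A ∈? Γ
    ... | yes D∈Γ = inj₁ (inj₁ (D∈Γ , tt))
    -- The diagonal formula `□ A` of Löb's rule is what makes this context strictly larger.
    ... | no D∉Γ
      with ih {□ A ∷ unbox Γ ++ Γ}
              (there ∘ ∈-++⁺ʳ (unbox Γ) , □ A , D∈S , here refl , D∉Γ) A
    ...   | inj₁ d = inj₂ (derived D∈S D∉Γ (□-löb d))
    ...   | inj₂ (Δ , Δ-sat , ⊆Δ , A∉Δ) =
      inj₁ (inj₂ (D∉Γ , Δ , Δ-sat
        , (⊆Δ ∘ there ∘ ∈-++⁺ʳ (unbox Γ) , □ A , D∈S , ⊆Δ (here refl) , D∉Γ)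
        , ⊆Δ ∘ there ∘ ∈-++⁺ˡ , A∉Δ))

    -- If all clauses hold, `Γ` is itself a world and membership settles `C`. Otherwise a reduction
    -- applies: proofs of all premises combine, and a refutation of one premise refutes `Γ` too,
    -- contexts being only enlarged.
    search-step : ∀ C → Outcome Γ C
    search-step C with All-⊎⁻ (All.tabulate analyse)
    ... | inj₁ clauses with C ∈? Γ
    ...   | yes C∈Γ = inj₁ (hypothesis C∈Γ)
    ...   | no C∉Γ  = inj₂ (Γ , saturated (All.lookup clauses) , id , C∉Γ)
    search-step C | inj₂ (Ds , new , rule) with All-⊎⁻ (All.map premise new)
      where
      premise : ∀ {D} → D ∈ S × D ∉ Γ →
                D ∷ Γ ⊢ᴸ C ⊎ (∃[ Δ ] Saturated Δ × Γ ⊆ Δ × C ∉ Δ)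
      premise (D∈S , D∉Γ) with ih (⊂-∷ D∈S D∉Γ) C
      ... | inj₁ d                           = inj₁ d
      ... | inj₂ (Δ , Δ-sat , D∷Γ⊆Δ , C∉Δ) = inj₂ (Δ , Δ-sat , D∷Γ⊆Δ ∘ there , C∉Δ)
    ...   | inj₁ ds         = inj₁ (rule ds)
    ...   | inj₂ refutation = inj₂ refutation

  search : ∀ Γ C → Outcome Γ C
  search Γ = go (⊃-wellFounded Γ)
    where
    go : ∀ {Γ} → Acc (flip _⊂_) Γ → ∀ C → Outcome Γ C
    go (acc rs) = search-step λ Γ⊂Δ → go (rs Γ⊂Δ)

  -- The canonical model and its truth lemma

  canonical : KripkeModel
  canonical = record
    { World         = ∃[ Γ ] Saturated Γ
    ; _≼_           = _⊆_ on proj₁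
    -- Strict growth inside `S` gives converse well-foundedness; the second condition makes the
    -- boxes in `Γ` true.
    ; _⊏_           = (λ Γ Δ → Γ ⊂ Δ × unbox Γ ⊆ Δ) on proj₁
    ; ≼-refl        = id
    ; ≼-trans       = λ u≼v v≼w → v≼w ∘ u≼v
    ; ⊏⇒≼           = proj₁ ∘ proj₁
    ; ≼-⊏-trans     = λ { {u , _} u≼v ((v≼w , D , D∈S , D∈w , D∉v) , unbox⊆) →
                          (v≼w ∘ u≼v , D , D∈S , D∈w , D∉v ∘ u≼v)
                        , unbox⊆ ∘ ∈-unbox⁺ ∘ u≼v ∘ ∈-unbox⁻ u }
    ; ⊐-wellFounded = Subrelation.wellFounded proj₁ (On.wellFounded proj₁ ⊃-wellFounded)
    ; V             = λ w p → var p ∈ proj₁ w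
    ; V-mono        = λ v≼w → v≼w
    }

  open KripkeModel canonical

  clause : ∀ {D} → D ∈ S → (w : World) → Clause (proj₁ w) D
  clause D∈S (_ , saturated clauses) = clauses D∈S

  true-clause : ∀ {D} → D ∈ S → (w : World) → D ∈ proj₁ w → TrueClause (proj₁ w) D
  true-clause D∈S w D∈w with clause D∈S w
  ... | inj₁ (_ , t)   = t
  ... | inj₂ (D∉w , _) = contradiction D∈w D∉w

  false-clause : ∀ {D} → D ∈ S → (w : World) → D ∉ proj₁ w → FalseClause (proj₁ w) D
  false-clause D∈S w D∉w with clause D∈S w
  ... | inj₁ (D∈w , _) = contradiction D∈w D∉w
  ... | inj₂ (_ , f)   = f

  -- Both halves of the truth lemma go by one induction on `D`, for all worlds at once, since an
  -- implication exchanges them on its antecedent.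
  ∈⇒⊩ : ∀ D → D ∈ S → (w : World) → D ∈ proj₁ w → w ⊩ D
  ∉⇒⊮ : ∀ D → D ∈ S → (w : World) → D ∉ proj₁ w → ¬ w ⊩ D

  ∈⇒⊩ (var _) D∈S w D∈w = D∈w
  ∈⇒⊩ ⊥       D∈S w D∈w = true-clause D∈S w D∈w
  ∈⇒⊩ (A ∧ B) D∈S w D∈w with true-clause D∈S w D∈w
  ... | A∈w , B∈w = ∈⇒⊩ A (S-closed D∈S (here refl)) w A∈w
                  , ∈⇒⊩ B (S-closed D∈S (there (here refl))) w B∈w
  ∈⇒⊩ (A ∨ B) D∈S w D∈w with true-clause D∈S w D∈w
  ... | inj₁ A∈w = inj₁ (∈⇒⊩ A (S-closed D∈S (here refl)) w A∈w)
  ... | inj₂ B∈w = inj₂ (∈⇒⊩ B (S-closed D∈S (there (here refl))) w B∈w)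
  -- The clause is read at `v`, which contains `A ⇒ B` because `w ≼ v`.
  ∈⇒⊩ (A ⇒ B) D∈S w D∈w {v} w≼v v⊩A with true-clause D∈S v (w≼v D∈w)
  ... | inj₁ A∉v = contradiction v⊩A (∉⇒⊮ A (S-closed D∈S (here refl)) v A∉v)
  ... | inj₂ B∈v = ∈⇒⊩ B (S-closed D∈S (there (here refl))) v B∈v
  ∈⇒⊩ (□ A)   D∈S w D∈w {v} (_ , unbox⊆v) =
    ∈⇒⊩ A (S-closed D∈S (here refl)) v (unbox⊆v (∈-unbox⁺ D∈w))

  ∉⇒⊮ (var _) D∈S w D∉w = D∉w
  ∉⇒⊮ ⊥       D∈S w D∉w = id
  ∉⇒⊮ (A ∧ B) D∈S w D∉w (w⊩A , w⊩B) with false-clause D∈S w D∉w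
  ... | inj₁ A∉w = ∉⇒⊮ A (S-closed D∈S (here refl)) w A∉w w⊩A
  ... | inj₂ B∉w = ∉⇒⊮ B (S-closed D∈S (there (here refl))) w B∉w w⊩B
  ∉⇒⊮ (A ∨ B) D∈S w D∉w with false-clause D∈S w D∉w
  ... | A∉w , B∉w = [ ∉⇒⊮ A (S-closed D∈S (here refl)) w A∉w
                    , ∉⇒⊮ B (S-closed D∈S (there (here refl))) w B∉w ]
  ∉⇒⊮ (A ⇒ B) D∈S w D∉w f with false-clause D∈S w D∉w
  ... | inj₁ (A∈w , B∉w) =
    ∉⇒⊮ B (S-closed D∈S (there (here refl))) w B∉w
      (f id (∈⇒⊩ A (S-closed D∈S (here refl)) w A∈w))
  ... | inj₂ (Δ , Δ-sat , w⊆Δ , A∈Δ , B∉Δ) =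
    ∉⇒⊮ B (S-closed D∈S (there (here refl))) (Δ , Δ-sat) B∉Δ
      (f w⊆Δ (∈⇒⊩ A (S-closed D∈S (here refl)) (Δ , Δ-sat) A∈Δ))
  ∉⇒⊮ (□ A)   D∈S w D∉w f with false-clause D∈S w D∉w
  ... | Δ , Δ-sat , w⊂Δ , unbox⊆Δ , A∉Δ =
    ∉⇒⊮ A (S-closed D∈S (here refl)) (Δ , Δ-sat) A∉Δ (f (w⊂Δ , unbox⊆Δ))

  -- The decision procedure

  decide : ∀ {A} → A ∈ S → Dec (LC ⊢ A)
  decide {A} A∈S with search [] A
  -- The empty context offers no hypotheses, so every axiom used belongs to `LC`.
  ... | inj₁ d                     = yes (⊢-mono (λ { (inj₁ a) → a }) d)
  ... | inj₂ (Δ , Δ-sat , _ , A∉Δ) = no λ d → ∉⇒⊮ A A∈S (Δ , Δ-sat) A∉Δ (soundness d)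

theorem4p26 : (A : Formula) → Dec (LC ⊢ A)
theorem4p26 A = Search.decide (subformulas A) (subformulas-closed A) (∈-subformulas A)
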